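{- Let $\mathcal{R}=\{\beta,\mu,\rho,\theta,\varepsilon\}$. The set $\mathcal{SN}_{\mathcal{R}}\cap\mathcal{T}_t$ is saturated.
   Context: $\lambda\mu$-terms: $\mathcal{T} ::= x \mid \lambda x.\mathcal{T} \mid (\mathcal{T})\mathcal{T} \mid [\alpha]\mathcal{T} \mid \mu\alpha.\mathcal{T}$, up to renaming of bound variables; substitutions avoid capture. Types $A ::= X \mid \bot \mid A\to B$; typing judgments $\Gamma\vdash M:A;\Theta$ by: $\Gamma,x:A\vdash x:A;\Theta$; $\lambda$-introduction to $A\to B$; application; from $\Gamma\vdash M:A;\alpha:A,\Theta$ infer $\Gamma\vdash[\alpha]M:\bot;\alpha:A,\Theta$; from $\Gamma\vdash M:\bot;\alpha:A,\Theta$ infer $\Gamma\vdash\mu\alpha.M:A;\Theta$. $\mathcal{T}_t$ = typable terms. $(M)P_1\dots P_k=(\dots((M)P_1)\dots)P_k$; $\mathcal{L}^{<\omega}$ = finite sequences from $\mathcal{L}$. $M[\alpha:=\beta]$ renames; $M[\alpha:=_rN]$ replaces inductively each $[\alpha]P$ by $[\alpha](P')N$, and $M[\alpha:=_rN_1\dots N_n]=M[\alpha:=_rN_1]\dots[\alpha:=_rN_n]$; $M_\alpha$ replaces inductively each $[\alpha]P$ by $P$. Rules: $\beta$: $(\lambda x.M)N\to M[x:=N]$; $\mu$: $(\mu\alpha.M)N\to\mu\alpha.M[\alpha:=_rN]$; $\rho$: $[\beta]\mu\alpha.M\to M[\alpha:=\beta]$; $\theta$: $\mu\alpha.[\alpha]M\to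 M$ if $\alpha\notin\mathrm{fv}(M)$; $\varepsilon$: $\mu\alpha.\mu\beta.M\to\mu\alpha.M_\beta$; $\mathcal{SN}_{\mathcal{R}}$: terms with no infinite $\mathcal{R}$-reduction sequence (one step contracts one redex anywhere). Saturated set: $\mathcal{B}\subseteq\mathcal{T}_t$ with (C1) $M\in\mathcal{B}\Rightarrow\lambda x.M\in\mathcal{B}$; (C2) $M\in\mathcal{B}$, $\mu\alpha.M\in\mathcal{T}_t\Rightarrow\mu\alpha.M\in\mathcal{B}$; (C3) $M\in\mathcal{B}$, $[\alpha]M\in\mathcal{T}_t\Rightarrow[\alpha]M\in\mathcal{B}$; (C4) $n\ge0$, $N_1,\dots,N_n\in\mathcal{B}$, $(x)N_1\dots N_n\in\mathcal{T}_t\Rightarrow(x)N_1\dots N_n\in\mathcal{B}$; (C5) $M,N\in\mathcal{T}_t$, $\bar P\in\mathcal{T}_t^{<\omega}$, $N\in\mathcal{B}$, $(\lambda x.M)N\bar P\in\mathcal{T}_t$, $(M[x:=N])\bar P\in\mathcal{B}\Rightarrow(\lambda x.M)N\bar P\in\mathcal{B}$; (C6) $M\in\mathcal{T}_t$, $\bar N\in\mathcal{B}^{<\omega}$, $(\mu\alpha.M)\bar N\in\mathcal{T}_t$, $\mu\alpha.M[\alpha:=_r\bar N]\in\mathcal{B}\Rightarrow(\mu\alpha.M)\bar N\in\mathcal{B}$. -}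

module Defs where

open import Data.Nat using (ℕ; zero; suc; _≡ᵇ_)
open import Data.Bool using (if_then_else_)
open import Data.List using (List; []; _∷_)
open import Data.List.Relation.Unary.All using (All)
open import Data.Product using (Σ; _×_)
open import Function using (id)

-- λμ-terms, with de Bruijn indices (terms up to α-renaming).
-- Two separate sorts of variables: λ-variables (var x) and
-- μ-variables / names ([α]M). `lam` binds λ-variable 0, `mu` binds name 0.

data Tm : Set where
  var  : ℕ → Tm
  lam  : Tm → Tm
  app  : Tm → Tm → Tm
  name : ℕ → Tm → Tm
  mu   : Tm → Tm

apps : Tm → List Tm → Tm
apps M []       = M
apps M (P ∷ Ps) = apps (app M P) Ps

ext : (ℕ → ℕ) → ℕ → ℕ
ext f zero    = zero
ext f (suc n) = suc (f n)

ren : (ℕ → ℕ) → (ℕ → ℕ) → Tm → Tm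
ren r s (var x)    = var (r x)
ren r s (lam M)    = lam (ren (ext r) s M)
ren r s (app M N)  = app (ren r s M) (ren r s N)
ren r s (name a M) = name (s a) (ren r s M)
ren r s (mu M)     = mu (ren r (ext s) M)

exts : (ℕ → Tm) → ℕ → Tm
exts σ zero    = var zero
exts σ (suc n) = ren suc id (σ n)

sub : (ℕ → Tm) → Tm → Tm
sub σ (var x)    = σ x
sub σ (lam M)    = lam (sub (exts σ) M)
sub σ (app M N)  = app (sub σ M) (sub σ N)
sub σ (name a M) = name a (sub σ M)
sub σ (mu M)     = mu (sub (λ n → ren id suc (σ n)) M)

sub0 : Tm → ℕ → Tm
sub0 N zero    = N
sub0 N (suc n) = var n

_[0:=_] : Tm → Tm → Tm
M [0:= N ] = sub (sub0 N) M

ren0 : ℕ → ℕ → ℕ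
ren0 b zero    = b
ren0 b (suc n) = n

srep : ℕ → Tm → Tm → Tm
srep a N (var x)    = var x
srep a N (lam M)    = lam (srep a (ren suc id N) M)
srep a N (app M P)  = app (srep a N M) (srep a N P)
srep a N (name b M) =
  if b ≡ᵇ a then name b (app (srep a N M) N) else name b (srep a N M)
srep a N (mu M)     = mu (srep (suc a) (ren id suc N) M)

-- M[α:=_r N₁ … Nₙ] = M[α:=_r N₁]…[α:=_r Nₙ], for α the name bound by an
-- enclosing μ (index 0); the Nᵢ come from outside that μ, hence are shifted.
srepList : List Tm → Tm → Tm
srepList []       M = M
srepList (N ∷ Ns) M = srepList Ns (srep zero (ren id suc N) M)

-- removing index a from the name indices (used only for b ≠ a)
skip : ℕ → ℕ → ℕ
skip zero    b       = Data.Nat.pred b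
skip (suc a) zero    = zero
skip (suc a) (suc b) = suc (skip a b)

-- M_α: replace each [α]P by P (α then no longer occurs; indices above drop)
erase : ℕ → Tm → Tm
erase a (var x)    = var x
erase a (lam M)    = lam (erase a M)
erase a (app M N)  = app (erase a M) (erase a N)
erase a (name b M) = if b ≡ᵇ a then erase a M else name (skip a b) (erase a M)
erase a (mu M)     = mu (erase (suc a) M)

infix 4 _⟶_
data _⟶_ : Tm → Tm → Set where
  β-rule : ∀ M N → app (lam M) N ⟶ M [0:= N ]
  μ-rule : ∀ M N → app (mu M) N ⟶ mu (srep zero (ren id suc N) M)
  ρ-rule : ∀ b M → name b (mu M) ⟶ ren id (ren0 b) M
  -- μα.[α]M → M when α ∉ fv(M): M is then (the shift of) a term not
  -- mentioning α
  θ-rule : ∀ M → mu (name zero (ren id suc M)) ⟶ M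
  ε-rule : ∀ M → mu (mu M) ⟶ mu (erase zero M)
  ξ-lam  : ∀ {M M'} → M ⟶ M' → lam M ⟶ lam M'
  ξ-appL : ∀ {M M' N} → M ⟶ M' → app M N ⟶ app M' N
  ξ-appR : ∀ {M N N'} → N ⟶ N' → app M N ⟶ app M N'
  ξ-name : ∀ {a M M'} → M ⟶ M' → name a M ⟶ name a M'
  ξ-mu   : ∀ {M M'} → M ⟶ M' → mu M ⟶ mu M'

data SN (M : Tm) : Set where
  sn : (∀ N → M ⟶ N → SN N) → SN M

infixr 7 _⇒_
data Ty : Set where
  X   : ℕ → Ty
  ⊥'  : Ty
  _⇒_ : Ty → Ty → Ty

Ctx : Set
Ctx = List Ty

infix 4 _∋_∶_
data _∋_∶_ : Ctx → ℕ → Ty → Set where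
  here  : ∀ {Γ A} → (A ∷ Γ) ∋ zero ∶ A
  there : ∀ {Γ A B n} → Γ ∋ n ∶ A → (B ∷ Γ) ∋ suc n ∶ A

infix 3 _⊢_∶_∣_
data _⊢_∶_∣_ : Ctx → Tm → Ty → Ctx → Set where
  ⊢var  : ∀ {Γ Θ x A} → Γ ∋ x ∶ A → Γ ⊢ var x ∶ A ∣ Θ
  ⊢lam  : ∀ {Γ Θ M A B} → (A ∷ Γ) ⊢ M ∶ B ∣ Θ → Γ ⊢ lam M ∶ A ⇒ B ∣ Θ
  ⊢app  : ∀ {Γ Θ M N A B} → Γ ⊢ M ∶ A ⇒ B ∣ Θ → Γ ⊢ N ∶ A ∣ Θ
        → Γ ⊢ app M N ∶ B ∣ Θ
  ⊢name : ∀ {Γ Θ a M A} → Θ ∋ a ∶ A → Γ ⊢ M ∶ A ∣ Θ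
        → Γ ⊢ name a M ∶ ⊥' ∣ Θ
  ⊢mu   : ∀ {Γ Θ M A} → Γ ⊢ M ∶ ⊥' ∣ (A ∷ Θ) → Γ ⊢ mu M ∶ A ∣ Θ

Typable : Tm → Set
Typable M = Σ Ctx λ Γ → Σ Ty λ A → Σ Ctx λ Θ → Γ ⊢ M ∶ A ∣ Θ

record Saturated (B : Tm → Set) : Set where
  field
    sub-Tt : ∀ M → B M → Typable M
    C1 : ∀ M → B M → B (lam M)
    C2 : ∀ M → B M → Typable (mu M) → B (mu M)
    C3 : ∀ a M → B M → Typable (name a M) → B (name a M)
    C4 : ∀ x (Ns : List Tm) → All B Ns → Typable (apps (var x) Ns)
       → B (apps (var x) Ns)
    C5 : ∀ M N (Ps : List Tm) → Typable M → Typable N → All Typable Ps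
       → B N → Typable (apps (app (lam M) N) Ps)
       → B (apps (M [0:= N ]) Ps) → B (apps (app (lam M) N) Ps)
    C6 : ∀ M (Ns : List Tm) → Typable M → All B Ns
       → Typable (apps (mu M) Ns)
       → B (mu (srepList Ns M)) → B (apps (mu M) Ns)

SN∩Tt : Tm → Set
SN∩Tt M = SN M × Typable M

{-# OPTIONS --safe #-}
module Submission where

-- Write R for the full reduction. On typable terms, SN for βμ already implies SN for R:
-- a ρ-, θ- or ε-step followed by a βμ-step can be replaced by a βμ-step followed by
-- R-steps (typing matters here: [a]P has type ⊥, so renaming or erasing names never
-- puts a λ or μ in function position), and ρ, θ, ε shrink the term. It then suffices to
-- check (C1)–(C6) for SN of βμ, where every redex is an application: (C1)–(C4) create no
-- redex, and (C5), (C6) follow by lexicographic induction on the arguments and on the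
-- contracted term.

-- The detour through βμ is forced by (C2) and (C3): for R, μα.M may be a new θ- or ε-redex and [α]M
-- a new ρ-redex, whereas both formers are inert for βμ. Coming back to R genuinely needs types:
-- μα.μβ.([β]λx.(x)x)λx.(x)x is βμ-normal, yet ε turns it into a term that reduces forever. After
-- the βμ-step that is moved forward, ρ, θ and ε alone do not always suffice: when θ uncovers the
-- function of a redex, the original βμ-step is still to be done afterwards. So no count of
-- postponed steps is carried along. Instead, the property that all βμ-reducts are SN for R is shown
-- to survive ρ, θ and ε, while the size decreases.

open import Defs
open import Data.Nat using (ℕ; zero; suc; _≡ᵇ_; _<_; _≤_; _+_; s≤s)
open import Data.Nat.Properties
  using (≤-reflexive; ≤-refl; +-mono-≤; +-monoˡ-<; +-monoʳ-<; m≤n⇒m≤1+n)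
open import Data.Nat.Induction using (<-wellFounded)
open import Data.Bool using (true; false; if_then_else_)
open import Data.List using (List; []; _∷_; _++_; map)
open import Data.List.Properties using (map-cong; map-∘; map-id; map-++; ++-identityʳ)
open import Data.List.Relation.Unary.All using (All; []; _∷_) renaming (map to All-map)
open import Data.Maybe using (Maybe; just; nothing) renaming (map to mapMaybe)
open import Data.Product using (∃-syntax; _×_; _,_; proj₁; proj₂)
open import Data.Sum using (_⊎_; inj₁; inj₂; [_,_]′)
open import Function using (id; _∘_; flip)
open import Induction.WellFounded using (Acc; acc)
open import Relation.Binary.Construct.Closure.ReflexiveTransitive
  using (Star; ε; _◅_; _◅◅_; gmap; return; kleisliStar)
open import Relation.Binary.Construct.Union using (_∪_)
open import Relation.Binary.PropositionalEquality
  using (_≡_; refl; sym; trans; cong; cong₂; subst; _≗_; module ≡-Reasoning)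

-- Renaming, substitution, M[α:=_rN] and M_α are all instances of one operation `act`:
-- an environment sends λ-variables to terms and a name a to (N̄, b), by which [a]P becomes
-- [b](P)N̄, or just (P)N̄ when there is no target b. All the commutation lemmas then
-- follow from the single composition law act-∘.
record Kont : Set where
  constructor _⟫_
  field
    args   : List Tm
    target : Maybe ℕ
open Kont

emit : Maybe ℕ → Tm → Tm
emit nothing  M = M
emit (just b) M = name b M

plug : Kont → Tm → Tm
plug k M = emit (target k) (apps M (args k))

renK : (ℕ → ℕ) → (ℕ → ℕ) → Kont → Kont
renK r s k = map (ren r s) (args k) ⟫ mapMaybe s (target k)

record Env : Set where
  constructor env
  field
    onVar  : ℕ → Tm
    onName : ℕ → Kont
open Env

underλ : Env → Env
underλ E = env (exts (onVar E)) (renK suc id ∘ onName E)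

extK : (ℕ → Kont) → ℕ → Kont
extK κ zero    = [] ⟫ just zero
extK κ (suc n) = renK id suc (κ n)

underμ : Env → Env
underμ E = env (ren id suc ∘ onVar E) (extK (onName E))

act : Env → Tm → Tm
act E (var x)    = onVar E x
act E (lam M)    = lam (act (underλ E) M)
act E (app M N)  = app (act E M) (act E N)
act E (name a M) = plug (onName E a) (act E M)
act E (mu M)     = mu (act (underμ E) M)

-- Made so that `act-plug` holds: acting on [b](P)N̄ acts on N̄ and then lets b append its own
-- arguments at the end.
actK : Env → Kont → Kont
actK E (Ns ⟫ nothing) = map (act E) Ns ⟫ nothing
actK E (Ns ⟫ just b)  = (map (act E) Ns ++ args (onName E b)) ⟫ target (onName E b)

infix 4 _≈_
record _≈_ (E F : Env) : Set where
  constructor _,_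
  field
    var≈  : onVar E ≗ onVar F
    name≈ : onName E ≗ onName F
open _≈_

_⊙_ : Env → Env → Env
F ⊙ E = env (act F ∘ onVar E) (actK F ∘ onName E)

renEnv : (ℕ → ℕ) → (ℕ → ℕ) → Env
renEnv r s = env (var ∘ r) (λ a → [] ⟫ just (s a))

subEnv : (ℕ → Tm) → Env
subEnv σ = env σ (λ a → [] ⟫ just a)

precomp : Env → (ℕ → ℕ) → (ℕ → ℕ) → Env
precomp E r s = env (onVar E ∘ r) (onName E ∘ s)

postcomp : (ℕ → ℕ) → (ℕ → ℕ) → Env → Env
postcomp r s E = env (ren r s ∘ onVar E) (renK r s ∘ onName E)

-- Laws of renaming

ext-cong : ∀ {f g} → f ≗ g → ext f ≗ ext g
ext-cong e zero    = refl
ext-cong e (suc n) = cong suc (e n)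

ren-cong : ∀ {r r' s s'} → r ≗ r' → s ≗ s' → ren r s ≗ ren r' s'
ren-cong e d (var x)    = cong var (e x)
ren-cong e d (lam M)    = cong lam (ren-cong (ext-cong e) d M)
ren-cong e d (app M N)  = cong₂ app (ren-cong e d M) (ren-cong e d N)
ren-cong e d (name a M) = cong₂ name (d a) (ren-cong e d M)
ren-cong e d (mu M)     = cong mu (ren-cong e (ext-cong d) M)

ext-id : ext id ≗ id
ext-id zero    = refl
ext-id (suc n) = refl

ext-∘ : ∀ f g → ext f ∘ ext g ≗ ext (f ∘ g)
ext-∘ f g zero    = refl
ext-∘ f g (suc n) = refl

ren-id : ren id id ≗ id
ren-id (var x)    = refl
ren-id (lam M)    = cong lam (trans (ren-cong ext-id (λ _ → refl) M) (ren-id M))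
ren-id (app M N)  = cong₂ app (ren-id M) (ren-id N)
ren-id (name a M) = cong (name a) (ren-id M)
ren-id (mu M)     = cong mu (trans (ren-cong (λ _ → refl) ext-id M) (ren-id M))

ren-∘ : ∀ r s r' s' → ren r s ∘ ren r' s' ≗ ren (r ∘ r') (s ∘ s')
ren-∘ r s r' s' (var x)    = refl
ren-∘ r s r' s' (lam M)    =
  cong lam (trans (ren-∘ (ext r) s (ext r') s' M) (ren-cong (ext-∘ r r') (λ _ → refl) M))
ren-∘ r s r' s' (app M N)  = cong₂ app (ren-∘ r s r' s' M) (ren-∘ r s r' s' N)
ren-∘ r s r' s' (name a M) = cong (name (s (s' a))) (ren-∘ r s r' s' M)
ren-∘ r s r' s' (mu M)     =
  cong mu (trans (ren-∘ r (ext s) r' (ext s') M) (ren-cong (λ _ → refl) (ext-∘ s s') M))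

renK-∘ : ∀ r s r' s' → renK r s ∘ renK r' s' ≗ renK (r ∘ r') (s ∘ s')
renK-∘ r s r' s' (Ns ⟫ t) =
  cong₂ _⟫_ (trans (sym (map-∘ Ns)) (map-cong (ren-∘ r s r' s') Ns)) (on t)
  where
  on : ∀ t → mapMaybe s (mapMaybe s' t) ≡ mapMaybe (s ∘ s') t
  on nothing  = refl
  on (just _) = refl

apps-map : ∀ (f : Tm → Tm) → (∀ M N → f (app M N) ≡ app (f M) (f N)) →
           ∀ M Ns → f (apps M Ns) ≡ apps (f M) (map f Ns)
apps-map f f-app M []       = refl
apps-map f f-app M (N ∷ Ns) =
  trans (apps-map f f-app (app M N) Ns) (cong (λ H → apps H (map f Ns)) (f-app M N))

apps-++ : ∀ M Ns Ps → apps M (Ns ++ Ps) ≡ apps (apps M Ns) Ps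
apps-++ M []       Ps = refl
apps-++ M (N ∷ Ns) Ps = apps-++ (app M N) Ns Ps

ren-plug : ∀ r s k M → ren r s (plug k M) ≡ plug (renK r s k) (ren r s M)
ren-plug r s (Ns ⟫ nothing) M = apps-map (ren r s) (λ _ _ → refl) M Ns
ren-plug r s (Ns ⟫ just b)  M = cong (name (s b)) (apps-map (ren r s) (λ _ _ → refl) M Ns)

act-plug : ∀ E k M → act E (plug k M) ≡ plug (actK E k) (act E M)
act-plug E (Ns ⟫ nothing) M = apps-map (act E) (λ _ _ → refl) M Ns
act-plug E (Ns ⟫ just b)  M =
  cong (emit (target (onName E b)))
    (trans (cong (λ H → apps H (args (onName E b))) (apps-map (act E) (λ _ _ → refl) M Ns))
           (sym (apps-++ (act E M) (map (act E) Ns) (args (onName E b)))))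

-- Laws of `act`

underλ-cong : ∀ {E F} → E ≈ F → underλ E ≈ underλ F
underλ-cong e = (λ { zero → refl ; (suc n) → cong (ren suc id) (var≈ e n) })
              , (λ a → cong (renK suc id) (name≈ e a))

underμ-cong : ∀ {E F} → E ≈ F → underμ E ≈ underμ F
underμ-cong e = (λ n → cong (ren id suc) (var≈ e n))
              , (λ { zero → refl ; (suc a) → cong (renK id suc) (name≈ e a) })

act-cong : ∀ {E F} → E ≈ F → act E ≗ act F
act-cong e (var x)    = var≈ e x
act-cong e (lam M)    = cong lam (act-cong (underλ-cong e) M)
act-cong e (app M N)  = cong₂ app (act-cong e M) (act-cong e N)
act-cong e (name a M) = cong₂ plug (name≈ e a) (act-cong e M)
act-cong e (mu M)     = cong mu (act-cong (underμ-cong e) M)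

ren≡act : ∀ r s → ren r s ≗ act (renEnv r s)
ren≡act r s (var x)    = refl
ren≡act r s (lam M)    =
  cong lam (trans (ren≡act (ext r) s M)
    (act-cong ((λ { zero → refl ; (suc n) → refl }) , (λ _ → refl)) M))
ren≡act r s (app M N)  = cong₂ app (ren≡act r s M) (ren≡act r s N)
ren≡act r s (name a M) = cong (name (s a)) (ren≡act r s M)
ren≡act r s (mu M)     =
  cong mu (trans (ren≡act r (ext s) M)
    (act-cong ((λ _ → refl) , (λ { zero → refl ; (suc n) → refl })) M))

act-id : act (renEnv id id) ≗ id
act-id M = trans (sym (ren≡act id id M)) (ren-id M)

act-ren : ∀ E r s → act E ∘ ren r s ≗ act (precomp E r s)
act-ren E r s (var x)    = refl
act-ren E r s (lam M)    =
  cong lam (trans (act-ren (underλ E) (ext r) s M)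
    (act-cong ((λ { zero → refl ; (suc n) → refl }) , (λ _ → refl)) M))
act-ren E r s (app M N)  = cong₂ app (act-ren E r s M) (act-ren E r s N)
act-ren E r s (name a M) = cong (plug (onName E (s a))) (act-ren E r s M)
act-ren E r s (mu M)     =
  cong mu (trans (act-ren (underμ E) r (ext s) M)
    (act-cong ((λ _ → refl) , (λ { zero → refl ; (suc n) → refl })) M))

ren-act : ∀ r s E → ren r s ∘ act E ≗ act (postcomp r s E)
ren-act r s E (var x)    = refl
ren-act r s E (lam M)    =
  cong lam (trans (ren-act (ext r) s (underλ E) M) (act-cong (onV , onN) M))
  where
  onV : onVar (postcomp (ext r) s (underλ E)) ≗ onVar (underλ (postcomp r s E))
  onV zero    = refl
  onV (suc n) = trans (ren-∘ (ext r) s suc id _) (sym (ren-∘ suc id r s _))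
  onN : onName (postcomp (ext r) s (underλ E)) ≗ onName (underλ (postcomp r s E))
  onN a = trans (renK-∘ (ext r) s suc id (onName E a)) (sym (renK-∘ suc id r s (onName E a)))
ren-act r s E (app M N)  = cong₂ app (ren-act r s E M) (ren-act r s E N)
ren-act r s E (name a M) =
  trans (ren-plug r s (onName E a) (act E M)) (cong (plug (renK r s (onName E a))) (ren-act r s E M))
ren-act r s E (mu M)     =
  cong mu (trans (ren-act r (ext s) (underμ E) M) (act-cong (onV , onN) M))
  where
  onV : onVar (postcomp r (ext s) (underμ E)) ≗ onVar (underμ (postcomp r s E))
  onV n = trans (ren-∘ r (ext s) id suc _) (sym (ren-∘ id suc r s _))
  onN : onName (postcomp r (ext s) (underμ E)) ≗ onName (underμ (postcomp r s E))
  onN zero    = refl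
  onN (suc n) = trans (renK-∘ r (ext s) id suc (onName E n)) (sym (renK-∘ id suc r s (onName E n)))

act-shiftλ : ∀ E → act (underλ E) ∘ ren suc id ≗ ren suc id ∘ act E
act-shiftλ E M = trans (act-ren (underλ E) suc id M) (sym (ren-act suc id E M))

act-shiftμ : ∀ E → act (underμ E) ∘ ren id suc ≗ ren id suc ∘ act E
act-shiftμ E M = trans (act-ren (underμ E) id suc M) (sym (ren-act id suc E M))

actK-renK : ∀ E r s → actK E ∘ renK r s ≗ actK (precomp E r s)
actK-renK E r s (Ns ⟫ nothing) =
  cong (_⟫ nothing) (trans (sym (map-∘ Ns)) (map-cong (act-ren E r s) Ns))
actK-renK E r s (Ns ⟫ just b)  =
  cong (λ Ps → (Ps ++ args (onName E (s b))) ⟫ target (onName E (s b)))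
       (trans (sym (map-∘ Ns)) (map-cong (act-ren E r s) Ns))

renK-actK : ∀ r s E → renK r s ∘ actK E ≗ actK (postcomp r s E)
renK-actK r s E (Ns ⟫ nothing) =
  cong (_⟫ nothing) (trans (sym (map-∘ Ns)) (map-cong (ren-act r s E) Ns))
renK-actK r s E (Ns ⟫ just b)  =
  cong (_⟫ mapMaybe s (target (onName E b)))
    (trans (map-++ (ren r s) (map (act E) Ns) (args (onName E b)))
      (cong (_++ map (ren r s) (args (onName E b)))
        (trans (sym (map-∘ Ns)) (map-cong (ren-act r s E) Ns))))

actK-renEnv : ∀ r s → actK (renEnv r s) ≗ renK r s
actK-renEnv r s (Ns ⟫ nothing) = cong (_⟫ nothing) (map-cong (sym ∘ ren≡act r s) Ns)
actK-renEnv r s (Ns ⟫ just b)  =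
  cong (_⟫ just (s b)) (trans (++-identityʳ _) (map-cong (sym ∘ ren≡act r s) Ns))

renK-id : renK id id ≗ id
renK-id (Ns ⟫ nothing) = cong (_⟫ nothing) (trans (map-cong ren-id Ns) (map-id Ns))
renK-id (Ns ⟫ just b)  = cong (_⟫ just b) (trans (map-cong ren-id Ns) (map-id Ns))

actK-id : actK (renEnv id id) ≗ id
actK-id k = trans (actK-renEnv id id k) (renK-id k)

-- Binders weaken environments by `ren`, so the cases of λ and μ rest on the two mixed laws
-- `act-ren` and `ren-act`, which had to be proved separately before.
act-∘ : ∀ F E → act F ∘ act E ≗ act (F ⊙ E)
act-∘ F E (var x)    = refl
act-∘ F E (lam M)    = cong lam (trans (act-∘ (underλ F) (underλ E) M) (act-cong (onV , onN) M))
  where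
  onV : onVar (underλ F ⊙ underλ E) ≗ onVar (underλ (F ⊙ E))
  onV zero    = refl
  onV (suc n) = act-shiftλ F (onVar E n)
  onN : onName (underλ F ⊙ underλ E) ≗ onName (underλ (F ⊙ E))
  onN a = trans (actK-renK (underλ F) suc id (onName E a)) (sym (renK-actK suc id F (onName E a)))
act-∘ F E (app M N)  = cong₂ app (act-∘ F E M) (act-∘ F E N)
act-∘ F E (name a M) =
  trans (act-plug F (onName E a) (act E M)) (cong (plug (actK F (onName E a))) (act-∘ F E M))
act-∘ F E (mu M)     = cong mu (trans (act-∘ (underμ F) (underμ E) M) (act-cong (onV , onN) M))
  where
  onV : onVar (underμ F ⊙ underμ E) ≗ onVar (underμ (F ⊙ E))
  onV n = act-shiftμ F (onVar E n)
  onN : onName (underμ F ⊙ underμ E) ≗ onName (underμ (F ⊙ E))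
  onN zero    = refl
  onN (suc n) = trans (actK-renK (underμ F) id suc (onName E n)) (sym (renK-actK id suc F (onName E n)))

-- The syntactic operations as instances of `act`

sub≡act : ∀ σ → sub σ ≗ act (subEnv σ)
sub≡act σ (var x)    = refl
sub≡act σ (lam M)    = cong lam (sub≡act (exts σ) M)
sub≡act σ (app M N)  = cong₂ app (sub≡act σ M) (sub≡act σ N)
sub≡act σ (name a M) = cong (name a) (sub≡act σ M)
sub≡act σ (mu M)     =
  cong mu (trans (sub≡act _ M)
    (act-cong ((λ _ → refl) , (λ { zero → refl ; (suc n) → refl })) M))

srepEnv : ℕ → Tm → Env
srepEnv a N = env var (λ b → (if b ≡ᵇ a then N ∷ [] else []) ⟫ just b)

srep≡act : ∀ a N → srep a N ≗ act (srepEnv a N)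
srep≡act a N (var x)    = refl
srep≡act a N (lam M)    = cong lam (trans (srep≡act a _ M) (act-cong (onV , onN) M))
  where
  onV : var ≗ exts var
  onV zero    = refl
  onV (suc n) = refl
  onN : onName (srepEnv a (ren suc id N)) ≗ onName (underλ (srepEnv a N))
  onN b with b ≡ᵇ a
  ... | true  = refl
  ... | false = refl
srep≡act a N (app M P)  = cong₂ app (srep≡act a N M) (srep≡act a N P)
srep≡act a N (name b M) with b ≡ᵇ a
... | true  = cong (λ P → name b (app P N)) (srep≡act a N M)
... | false = cong (name b) (srep≡act a N M)
srep≡act a N (mu M)     = cong mu (trans (srep≡act (suc a) _ M) (act-cong ((λ _ → refl) , onN) M))
  where
  onN : onName (srepEnv (suc a) (ren id suc N)) ≗ onName (underμ (srepEnv a N))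
  onN zero    = refl
  onN (suc b) with b ≡ᵇ a
  ... | true  = refl
  ... | false = refl

eraseEnv : ℕ → Env
eraseEnv a = env var (λ b → [] ⟫ (if b ≡ᵇ a then nothing else just (skip a b)))

erase≡act : ∀ a → erase a ≗ act (eraseEnv a)
erase≡act a (var x)    = refl
erase≡act a (lam M)    = cong lam (trans (erase≡act a M) (act-cong (onV , onN) M))
  where
  onV : var ≗ exts var
  onV zero    = refl
  onV (suc n) = refl
  onN : onName (eraseEnv a) ≗ onName (underλ (eraseEnv a))
  onN b with b ≡ᵇ a
  ... | true  = refl
  ... | false = refl
erase≡act a (app M P)  = cong₂ app (erase≡act a M) (erase≡act a P)
erase≡act a (name b M) with b ≡ᵇ a
... | true  = erase≡act a M
... | false = cong (name (skip a b)) (erase≡act a M)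
erase≡act a (mu M)     = cong mu (trans (erase≡act (suc a) M) (act-cong ((λ _ → refl) , onN) M))
  where
  onN : onName (eraseEnv (suc a)) ≗ onName (underμ (eraseEnv a))
  onN zero    = refl
  onN (suc b) with b ≡ᵇ a
  ... | true  = refl
  ... | false = refl

argsEnv : List Tm → Env
argsEnv Ns = env var κ
  where
  κ : ℕ → Kont
  κ zero    = Ns ⟫ just zero
  κ (suc n) = [] ⟫ just (suc n)

srep0≡act : ∀ N → srep zero N ≗ act (argsEnv (N ∷ []))
srep0≡act N M = trans (srep≡act zero N M)
  (act-cong ((λ _ → refl) , (λ { zero → refl ; (suc n) → refl })) M)

act-argsEnv-shift : ∀ Ns → act (argsEnv Ns) ∘ ren id suc ≗ ren id suc
act-argsEnv-shift Ns M = trans (act-ren (argsEnv Ns) id suc M) (sym (ren≡act id suc M))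

-- Successive replacements amount to appending all arguments at once: those already inserted are
-- shifted, hence do not mention name 0, and later replacements leave them alone.
srepList≡act : ∀ Ns → srepList Ns ≗ act (argsEnv (map (ren id suc) Ns))
srepList≡act []       M = sym (trans (act-cong ((λ _ → refl) , (λ { zero → refl ; (suc n) → refl })) M) (act-id M))
srepList≡act (N ∷ Ns) M = begin
  srepList Ns (srep zero (ren id suc N) M)
    ≡⟨ srepList≡act Ns _ ⟩
  act F (srep zero (ren id suc N) M)
    ≡⟨ cong (act F) (srep0≡act _ M) ⟩
  act F (act (argsEnv (ren id suc N ∷ [])) M)
    ≡⟨ act-∘ F _ M ⟩
  act (F ⊙ argsEnv (ren id suc N ∷ [])) M
    ≡⟨ act-cong ((λ _ → refl) , onN) M ⟩
  act (argsEnv (map (ren id suc) (N ∷ Ns))) M ∎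
  where
  open ≡-Reasoning
  F = argsEnv (map (ren id suc) Ns)
  onN : onName (F ⊙ argsEnv (ren id suc N ∷ [])) ≗ onName (argsEnv (map (ren id suc) (N ∷ Ns)))
  onN zero    = cong (λ P → (P ∷ map (ren id suc) Ns) ⟫ just zero) (act-argsEnv-shift _ N)
  onN (suc n) = refl

-- Commutation of `act` with the contracta of the rules

act-sub0 : ∀ E M N → act E (M [0:= N ]) ≡ act (underλ E) M [0:= act E N ]
act-sub0 E M N = begin
  act E (M [0:= N ])
    ≡⟨ cong (act E) (sub≡act _ M) ⟩
  act E (act (subEnv (sub0 N)) M)
    ≡⟨ act-∘ E _ M ⟩
  act (E ⊙ subEnv (sub0 N)) M
    ≡⟨ act-cong (onV , onN) M ⟩
  act (subEnv (sub0 (act E N)) ⊙ underλ E) M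
    ≡⟨ act-∘ _ (underλ E) M ⟨
  act (subEnv (sub0 (act E N))) (act (underλ E) M)
    ≡⟨ sub≡act (sub0 (act E N)) (act (underλ E) M) ⟨
  act (underλ E) M [0:= act E N ] ∎
  where
  open ≡-Reasoning
  onV : onVar (E ⊙ subEnv (sub0 N)) ≗ onVar (subEnv (sub0 (act E N)) ⊙ underλ E)
  onV zero    = refl
  onV (suc n) = sym (trans (act-ren _ suc id (onVar E n)) (act-id (onVar E n)))
  onN : onName (E ⊙ subEnv (sub0 N)) ≗ onName (subEnv (sub0 (act E N)) ⊙ underλ E)
  onN a = sym (trans (actK-renK _ suc id (onName E a)) (actK-id (onName E a)))

act-srep0 : ∀ E M N → act (underμ E) (srep zero (ren id suc N) M)
                    ≡ srep zero (ren id suc (act E N)) (act (underμ E) M)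
act-srep0 E M N = begin
  act (underμ E) (srep zero (ren id suc N) M)
    ≡⟨ cong (act (underμ E)) (srep0≡act _ M) ⟩
  act (underμ E) (act (argsEnv (ren id suc N ∷ [])) M)
    ≡⟨ act-∘ (underμ E) _ M ⟩
  act (underμ E ⊙ argsEnv (ren id suc N ∷ [])) M
    ≡⟨ act-cong (onV , onN) M ⟩
  act (F ⊙ underμ E) M
    ≡⟨ act-∘ F (underμ E) M ⟨
  act F (act (underμ E) M)
    ≡⟨ srep0≡act (ren id suc (act E N)) (act (underμ E) M) ⟨
  srep zero (ren id suc (act E N)) (act (underμ E) M) ∎
  where
  open ≡-Reasoning
  F = argsEnv (ren id suc (act E N) ∷ [])
  onV : onVar (underμ E ⊙ argsEnv (ren id suc N ∷ [])) ≗ onVar (F ⊙ underμ E)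
  onV n = sym (act-argsEnv-shift _ (onVar E n))
  onN : onName (underμ E ⊙ argsEnv (ren id suc N ∷ [])) ≗ onName (F ⊙ underμ E)
  onN zero    = cong (λ P → (P ∷ []) ⟫ just zero) (act-shiftμ E N)
  onN (suc n) = sym (trans (actK-renK F id suc (onName E n)) (actK-renEnv id suc (onName E n)))

act-erase0 : ∀ E M → act E (erase zero M) ≡ erase zero (act (underμ E) M)
act-erase0 E M = begin
  act E (erase zero M)
    ≡⟨ cong (act E) (erase≡act zero M) ⟩
  act E (act (eraseEnv zero) M)
    ≡⟨ act-∘ E _ M ⟩
  act (E ⊙ eraseEnv zero) M
    ≡⟨ act-cong (onV , onN) M ⟩
  act (eraseEnv zero ⊙ underμ E) M
    ≡⟨ act-∘ (eraseEnv zero) _ M ⟨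
  act (eraseEnv zero) (act (underμ E) M)
    ≡⟨ erase≡act zero (act (underμ E) M) ⟨
  erase zero (act (underμ E) M) ∎
  where
  open ≡-Reasoning
  onV : onVar (E ⊙ eraseEnv zero) ≗ onVar (eraseEnv zero ⊙ underμ E)
  onV n = sym (trans (act-ren _ id suc (onVar E n)) (act-id _))
  onN : onName (E ⊙ eraseEnv zero) ≗ onName (eraseEnv zero ⊙ underμ E)
  onN zero    = refl
  onN (suc n) = sym (trans (actK-renK _ id suc (onName E n)) (actK-id _))

-- For ρ: E turns [b]μα.M into [c](μα.M')N̄. Once μ-steps have moved N̄ into M', ρ applies again,
-- and its contractum is the right-hand side.
act-ren0 : ∀ E b c Ns M → onName E b ≡ Ns ⟫ just c →
           act E (ren id (ren0 b) M) ≡ ren id (ren0 c) (srepList Ns (act (underμ E) M))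
act-ren0 E b c Ns M eq = begin
  act E (ren id (ren0 b) M)
    ≡⟨ act-ren E id (ren0 b) M ⟩
  act (precomp E id (ren0 b)) M
    ≡⟨ act-cong (onV , onN) M ⟩
  act (F ⊙ underμ E) M
    ≡⟨ act-∘ F (underμ E) M ⟨
  act F (act (underμ E) M)
    ≡⟨ ren-act id (ren0 c) (argsEnv ↑Ns) (act (underμ E) M) ⟨
  ren id (ren0 c) (act (argsEnv ↑Ns) (act (underμ E) M))
    ≡⟨ cong (ren id (ren0 c)) (srepList≡act Ns _) ⟨
  ren id (ren0 c) (srepList Ns (act (underμ E) M)) ∎
  where
  open ≡-Reasoning
  ↑Ns = map (ren id suc) Ns
  F = postcomp id (ren0 c) (argsEnv ↑Ns)
  onV : onVar (precomp E id (ren0 b)) ≗ onVar (F ⊙ underμ E)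
  onV n = sym (trans (act-ren F id suc (onVar E n)) (act-id _))
  onN : onName (precomp E id (ren0 b)) ≗ onName (F ⊙ underμ E)
  onN zero    = trans eq (cong (_⟫ just c) (sym
    (trans (sym (map-∘ Ns))
      (trans (map-cong (λ N → trans (ren-∘ id (ren0 c) id suc N) (ren-id N)) Ns) (map-id Ns)))))
  onN (suc n) = sym (trans (actK-renK F id suc (onName E n)) (actK-id _))

-- Reduction

-- Parametric in the root rules, so that βμ, ρθε and their union share the congruence cases and a
-- step of the union can be sorted by its rule.
data Closure (R : Tm → Tm → Set) : Tm → Tm → Set where
  base   : ∀ {M N} → R M N → Closure R M N
  ξ-lam  : ∀ {M M'} → Closure R M M' → Closure R (lam M) (lam M')
  ξ-appL : ∀ {M M' N} → Closure R M M' → Closure R (app M N) (app M' N)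
  ξ-appR : ∀ {M N N'} → Closure R N N' → Closure R (app M N) (app M N')
  ξ-name : ∀ {a M M'} → Closure R M M' → Closure R (name a M) (name a M')
  ξ-mu   : ∀ {M M'} → Closure R M M' → Closure R (mu M) (mu M')

data βμ : Tm → Tm → Set where
  β : ∀ M N → βμ (app (lam M) N) (M [0:= N ])
  μ : ∀ M N → βμ (app (mu M) N) (mu (srep zero (ren id suc N) M))

data ρθε : Tm → Tm → Set where
  ρ : ∀ b M → ρθε (name b (mu M)) (ren id (ren0 b) M)
  θ : ∀ M → ρθε (mu (name zero (ren id suc M))) M
  ε : ∀ M → ρθε (mu (mu M)) (mu (erase zero M))

infix 4 _⟶βμ_ _⟶ρθε_ _⟶*_
_⟶βμ_ _⟶ρθε_ _⟶*_ : Tm → Tm → Set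
_⟶βμ_  = Closure βμ
_⟶ρθε_ = Closure ρθε
_⟶*_   = Star (Closure (βμ ∪ ρθε))

closure-map : ∀ {R S} → (∀ {M N} → R M N → S M N) →
              ∀ {M N} → Closure R M N → Closure S M N
closure-map f (base r)   = base (f r)
closure-map f (ξ-lam r)  = ξ-lam (closure-map f r)
closure-map f (ξ-appL r) = ξ-appL (closure-map f r)
closure-map f (ξ-appR r) = ξ-appR (closure-map f r)
closure-map f (ξ-name r) = ξ-name (closure-map f r)
closure-map f (ξ-mu r)   = ξ-mu (closure-map f r)

closure-split : ∀ {R S M N} → Closure (R ∪ S) M N → Closure R M N ⊎ Closure S M N
closure-split (base (inj₁ r)) = inj₁ (base r)
closure-split (base (inj₂ s)) = inj₂ (base s)
closure-split (ξ-lam r)  = [ inj₁ ∘ ξ-lam  , inj₂ ∘ ξ-lam  ]′ (closure-split r)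
closure-split (ξ-appL r) = [ inj₁ ∘ ξ-appL , inj₂ ∘ ξ-appL ]′ (closure-split r)
closure-split (ξ-appR r) = [ inj₁ ∘ ξ-appR , inj₂ ∘ ξ-appR ]′ (closure-split r)
closure-split (ξ-name r) = [ inj₁ ∘ ξ-name , inj₂ ∘ ξ-name ]′ (closure-split r)
closure-split (ξ-mu r)   = [ inj₁ ∘ ξ-mu   , inj₂ ∘ ξ-mu   ]′ (closure-split r)

closure⇒⟶ : ∀ {M N} → Closure (βμ ∪ ρθε) M N → M ⟶ N
closure⇒⟶ (base (inj₁ (β M N))) = β-rule M N
closure⇒⟶ (base (inj₁ (μ M N))) = μ-rule M N
closure⇒⟶ (base (inj₂ (ρ b M))) = ρ-rule b M
closure⇒⟶ (base (inj₂ (θ M)))   = θ-rule M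
closure⇒⟶ (base (inj₂ (ε M)))   = ε-rule M
closure⇒⟶ (ξ-lam r)  = ξ-lam (closure⇒⟶ r)
closure⇒⟶ (ξ-appL r) = ξ-appL (closure⇒⟶ r)
closure⇒⟶ (ξ-appR r) = ξ-appR (closure⇒⟶ r)
closure⇒⟶ (ξ-name r) = ξ-name (closure⇒⟶ r)
closure⇒⟶ (ξ-mu r)   = ξ-mu (closure⇒⟶ r)

⟶⇒closure : ∀ {M N} → M ⟶ N → Closure (βμ ∪ ρθε) M N
⟶⇒closure (β-rule M N) = base (inj₁ (β M N))
⟶⇒closure (μ-rule M N) = base (inj₁ (μ M N))
⟶⇒closure (ρ-rule b M) = base (inj₂ (ρ b M))
⟶⇒closure (θ-rule M)   = base (inj₂ (θ M))
⟶⇒closure (ε-rule M)   = base (inj₂ (ε M))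
⟶⇒closure (ξ-lam r)  = ξ-lam (⟶⇒closure r)
⟶⇒closure (ξ-appL r) = ξ-appL (⟶⇒closure r)
⟶⇒closure (ξ-appR r) = ξ-appR (⟶⇒closure r)
⟶⇒closure (ξ-name r) = ξ-name (⟶⇒closure r)
⟶⇒closure (ξ-mu r)   = ξ-mu (⟶⇒closure r)

βμ⇒⟶ : ∀ {M N} → M ⟶βμ N → M ⟶ N
βμ⇒⟶ = closure⇒⟶ ∘ closure-map inj₁

ρθε⇒⟶ : ∀ {M N} → M ⟶ρθε N → M ⟶ N
ρθε⇒⟶ = closure⇒⟶ ∘ closure-map inj₂

βμ*⇒* : ∀ {M N} → Star _⟶βμ_ M N → M ⟶* N
βμ*⇒* = gmap id (closure-map inj₁)

apps-step : ∀ {R H H'} Ns → Closure R H H' → Closure R (apps H Ns) (apps H' Ns)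
apps-step []       r = r
apps-step (N ∷ Ns) r = apps-step Ns (ξ-appL r)

emit-step : ∀ {R H H'} t → Closure R H H' → Closure R (emit t H) (emit t H')
emit-step nothing  r = r
emit-step (just b) r = ξ-name r

plug-step : ∀ {R H H'} k → Closure R H H' → Closure R (plug k H) (plug k H')
plug-step k r = emit-step (target k) (apps-step (args k) r)

-- `act E` neither copies nor deletes parts of the term it acts on, so a step there stays exactly
-- one step. This exactness provides the strict descent in (C5) and (C6).
act-βμ : ∀ E {M M'} → M ⟶βμ M' → act E M ⟶βμ act E M'
act-βμ E (base (β M N)) =
  subst (act E (app (lam M) N) ⟶βμ_) (sym (act-sub0 E M N)) (base (β (act (underλ E) M) (act E N)))
act-βμ E (base (μ M N)) =
  subst (act E (app (mu M) N) ⟶βμ_) (cong mu (sym (act-srep0 E M N))) (base (μ (act (underμ E) M) (act E N)))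
act-βμ E (ξ-lam r)          = ξ-lam (act-βμ (underλ E) r)
act-βμ E (ξ-appL r)         = ξ-appL (act-βμ E r)
act-βμ E (ξ-appR r)         = ξ-appR (act-βμ E r)
act-βμ E (ξ-name {a = a} r) = plug-step (onName E a) (act-βμ E r)
act-βμ E (ξ-mu r)           = ξ-mu (act-βμ (underμ E) r)

-- Erasing b would turn the ρ-redex [b]μα.M into (μα.M')N̄ with no name in front, where ρ no longer
-- applies; stability of ρθε is therefore limited to environments that keep a target for every name.
Total : Env → Set
Total E = ∀ a → ∃[ Ns ] ∃[ b ] onName E a ≡ Ns ⟫ just b

total-underλ : ∀ {E} → Total E → Total (underλ E)
total-underλ t a with t a
... | Ns , b , eq = _ , _ , cong (renK suc id) eq

total-underμ : ∀ {E} → Total E → Total (underμ E)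
total-underμ t zero = _ , _ , refl
total-underμ t (suc a) with t a
... | Ns , b , eq = _ , _ , cong (renK id suc) eq

mu-args* : ∀ M Ns → Star _⟶βμ_ (apps (mu M) Ns) (mu (srepList Ns M))
mu-args* M []       = ε
mu-args* M (N ∷ Ns) = apps-step Ns (base (μ M N)) ◅ mu-args* _ Ns

act-ρθε : ∀ {E M M'} → Total E → M ⟶ρθε M' → act E M ⟶* act E M'
act-ρθε {E} t (base (ρ b M)) with onName E b in eq | t b
-- The arguments that E gives to b separate the name from the μ. They are absorbed by μ-steps first,
-- which is why the conclusion is about the full reduction.
... | .(Ns ⟫ just c) | Ns , c , refl =
  gmap (name c) ξ-name (βμ*⇒* (mu-args* (act (underμ E) M) Ns))
  ◅◅ subst (name c (mu (srepList Ns (act (underμ E) M))) ⟶*_) (sym (act-ren0 E b c Ns M eq))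
           (return (base (inj₂ (ρ c _))))
act-ρθε {E} t (base (θ M)) =
  subst (λ P → mu (name zero P) ⟶* act E M) (sym (act-shiftμ E M))
        (return (base (inj₂ (θ (act E M)))))
act-ρθε {E} t (base (ε M)) =
  subst (λ P → act E (mu (mu M)) ⟶* mu P) (sym (act-erase0 (underμ E) M))
        (return (base (inj₂ (ε (act (underμ (underμ E)) M)))))
act-ρθε {E} t (ξ-lam r)          = gmap lam ξ-lam (act-ρθε (total-underλ {E} t) r)
act-ρθε t (ξ-appL r)             = gmap _ ξ-appL (act-ρθε t r)
act-ρθε t (ξ-appR r)             = gmap _ ξ-appR (act-ρθε t r)
act-ρθε {E} t (ξ-name {a = a} r) = gmap _ (plug-step (onName E a)) (act-ρθε t r)
act-ρθε {E} t (ξ-mu r)           = gmap mu ξ-mu (act-ρθε (total-underμ {E} t) r)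

-- Here the term is fixed and the environment reduces: its entries may be copied or dropped, so one
-- step becomes any number. Stability under `ren` is all that is asked of R, since binders merely
-- weaken the entries.
module Monotonicity (R : Tm → Tm → Set)
  (ren* : ∀ r s {M N} → Closure R M N → Star (Closure R) (ren r s M) (ren r s N)) where

  infix 4 _↠_ _↠K_ _↠E_
  _↠_ : Tm → Tm → Set
  _↠_ = Star (Closure R)

  data _↠s_ : List Tm → List Tm → Set where
    []  : [] ↠s []
    _∷_ : ∀ {N N' Ns Ns'} → N ↠ N' → Ns ↠s Ns' → (N ∷ Ns) ↠s (N' ∷ Ns')

  data _↠K_ : Kont → Kont → Set where
    _⟫_ : ∀ {Ns Ns'} → Ns ↠s Ns' → ∀ t → (Ns ⟫ t) ↠K (Ns' ⟫ t)

  record _↠E_ (E F : Env) : Set where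
    constructor _,_
    field
      var↠  : ∀ x → onVar E x ↠ onVar F x
      name↠ : ∀ a → onName E a ↠K onName F a
  open _↠E_

  ↠s-refl : ∀ Ns → Ns ↠s Ns
  ↠s-refl []       = []
  ↠s-refl (N ∷ Ns) = ε ∷ ↠s-refl Ns

  ↠K-refl : ∀ k → k ↠K k
  ↠K-refl (Ns ⟫ t) = ↠s-refl Ns ⟫ t

  ren-↠ : ∀ r s {M N} → M ↠ N → ren r s M ↠ ren r s N
  ren-↠ r s = kleisliStar (ren r s) (ren* r s)

  ren-↠s : ∀ r s {Ns Ns'} → Ns ↠s Ns' → map (ren r s) Ns ↠s map (ren r s) Ns'
  ren-↠s r s []       = []
  ren-↠s r s (p ∷ ps) = ren-↠ r s p ∷ ren-↠s r s ps

  ren-↠K : ∀ r s {k k'} → k ↠K k' → renK r s k ↠K renK r s k'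
  ren-↠K r s (ps ⟫ t) = ren-↠s r s ps ⟫ mapMaybe s t

  underλ-↠ : ∀ {E F} → E ↠E F → underλ E ↠E underλ F
  underλ-↠ p = (λ { zero → ε ; (suc n) → ren-↠ suc id (var↠ p n) })
             , (λ a → ren-↠K suc id (name↠ p a))

  underμ-↠ : ∀ {E F} → E ↠E F → underμ E ↠E underμ F
  underμ-↠ p = (λ n → ren-↠ id suc (var↠ p n))
             , (λ { zero → [] ⟫ _ ; (suc n) → ren-↠K id suc (name↠ p n) })

  app-↠ : ∀ {M M' N N'} → M ↠ M' → N ↠ N' → app M N ↠ app M' N'
  app-↠ p q = gmap _ ξ-appL p ◅◅ gmap _ ξ-appR q

  apps-↠ : ∀ {M M' Ns Ns'} → M ↠ M' → Ns ↠s Ns' → apps M Ns ↠ apps M' Ns'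
  apps-↠ p []       = p
  apps-↠ p (q ∷ qs) = apps-↠ (app-↠ p q) qs

  plug-↠ : ∀ {k k' M M'} → k ↠K k' → M ↠ M' → plug k M ↠ plug k' M'
  plug-↠ (ps ⟫ t) p = gmap (emit t) (emit-step t) (apps-↠ p ps)

  act-↠ : ∀ {E F} → E ↠E F → ∀ M → act E M ↠ act F M
  act-↠ p (var x)    = var↠ p x
  act-↠ p (lam M)    = gmap lam ξ-lam (act-↠ (underλ-↠ p) M)
  act-↠ p (app M N)  = app-↠ (act-↠ p M) (act-↠ p N)
  act-↠ p (name a M) = plug-↠ (name↠ p a) (act-↠ p M)
  act-↠ p (mu M)     = gmap mu ξ-mu (act-↠ (underμ-↠ p) M)

  sub0-↠ : ∀ M {N N'} → N ↠ N' → M [0:= N ] ↠ M [0:= N' ]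
  sub0-↠ M {N} {N'} p
    rewrite sub≡act (sub0 N) M | sub≡act (sub0 N') M =
    act-↠ ((λ { zero → p ; (suc n) → ε }) , (λ a → ↠K-refl _)) M

  srepList-↠ : ∀ {Ns Ns'} M → Ns ↠s Ns' → srepList Ns M ↠ srepList Ns' M
  srepList-↠ {Ns} {Ns'} M ps
    rewrite srepList≡act Ns M | srepList≡act Ns' M =
    act-↠ ((λ _ → ε) , (λ { zero → ren-↠s id suc ps ⟫ _ ; (suc n) → ↠K-refl _ })) M

ren-βμ : ∀ r s {M N} → M ⟶βμ N → ren r s M ⟶βμ ren r s N
ren-βμ r s {M} {N} p rewrite ren≡act r s M | ren≡act r s N = act-βμ (renEnv r s) p

act-closure : ∀ {E M M'} → Total E → Closure (βμ ∪ ρθε) M M' → act E M ⟶* act E M'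
act-closure {E} t r =
  [ return ∘ closure-map inj₁ ∘ act-βμ E , act-ρθε t ]′ (closure-split r)

ren-closure : ∀ r s {M N} → Closure (βμ ∪ ρθε) M N → ren r s M ⟶* ren r s N
ren-closure r s {M} {N} p rewrite ren≡act r s M | ren≡act r s N =
  act-closure (λ a → [] , s a , refl) p

module Full = Monotonicity (βμ ∪ ρθε) ren-closure
module Mono = Monotonicity βμ (λ r s → return ∘ ren-βμ r s)

-- Typing and subject reduction

Ren : Ctx → Ctx → (ℕ → ℕ) → Set
Ren Γ Δ r = ∀ {x A} → Γ ∋ x ∶ A → Δ ∋ r x ∶ A

ext-Ren : ∀ {Γ Δ r A} → Ren Γ Δ r → Ren (A ∷ Γ) (A ∷ Δ) (ext r)
ext-Ren h here      = here
ext-Ren h (there i) = there (h i)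

⊢ren : ∀ {Γ Δ Θ Ψ r s M A} → Ren Γ Δ r → Ren Θ Ψ s →
       Γ ⊢ M ∶ A ∣ Θ → Δ ⊢ ren r s M ∶ A ∣ Ψ
⊢ren h k (⊢var i)     = ⊢var (h i)
⊢ren h k (⊢lam ⊢M)    = ⊢lam (⊢ren (ext-Ren h) k ⊢M)
⊢ren h k (⊢app ⊢M ⊢N) = ⊢app (⊢ren h k ⊢M) (⊢ren h k ⊢N)
⊢ren h k (⊢name i ⊢M) = ⊢name (k i) (⊢ren h k ⊢M)
⊢ren h k (⊢mu ⊢M)     = ⊢mu (⊢ren h (ext-Ren k) ⊢M)

Unren : Ctx → Ctx → (ℕ → ℕ) → Set
Unren Γ Δ r = ∀ {x A} → Δ ∋ r x ∶ A → Γ ∋ x ∶ A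

ext-Unren : ∀ {Γ Δ r A} → Unren Γ Δ r → Unren (A ∷ Γ) (A ∷ Δ) (ext r)
ext-Unren h {zero}  here      = here
ext-Unren h {suc x} (there i) = there (h i)

-- Strengthening, for θ: the redex gives a typing only of the shift of M, in a context that still
-- has the bound name.
⊢unren : ∀ {Γ Δ Θ Ψ r s A} M → Unren Γ Δ r → Unren Θ Ψ s →
         Δ ⊢ ren r s M ∶ A ∣ Ψ → Γ ⊢ M ∶ A ∣ Θ
⊢unren (var x)    h k (⊢var i)     = ⊢var (h i)
⊢unren (lam M)    h k (⊢lam ⊢M)    = ⊢lam (⊢unren M (ext-Unren h) k ⊢M)
⊢unren (app M N)  h k (⊢app ⊢M ⊢N) = ⊢app (⊢unren M h k ⊢M) (⊢unren N h k ⊢N)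
⊢unren (name a M) h k (⊢name i ⊢M) = ⊢name (k i) (⊢unren M h k ⊢M)
⊢unren (mu M)     h k (⊢mu ⊢M)     = ⊢mu (⊢unren M h (ext-Unren k) ⊢M)

infix 3 _⊢_∶_⇛_∣_ _⊢K_∶_∣_
data _⊢_∶_⇛_∣_ (Γ : Ctx) : List Tm → Ty → Ty → Ctx → Set where
  []  : ∀ {A Θ} → Γ ⊢ [] ∶ A ⇛ A ∣ Θ
  _∷_ : ∀ {N Ns A B C Θ} → Γ ⊢ N ∶ A ∣ Θ → Γ ⊢ Ns ∶ B ⇛ C ∣ Θ → Γ ⊢ N ∷ Ns ∶ A ⇒ B ⇛ C ∣ Θ

-- [a]P has type ⊥, and so must its replacement: a target restores ⊥ by itself, while without one
-- the application has to end in ⊥.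
data _⊢K_∶_∣_ (Γ : Ctx) : Kont → Ty → Ctx → Set where
  erased : ∀ {Ns A Θ} → Γ ⊢ Ns ∶ A ⇛ ⊥' ∣ Θ → Γ ⊢K Ns ⟫ nothing ∶ A ∣ Θ
  throw  : ∀ {Ns A B b Θ} → Γ ⊢ Ns ∶ A ⇛ B ∣ Θ → Θ ∋ b ∶ B → Γ ⊢K Ns ⟫ just b ∶ A ∣ Θ

⊢apps : ∀ {Γ Θ M Ns A B} → Γ ⊢ M ∶ A ∣ Θ → Γ ⊢ Ns ∶ A ⇛ B ∣ Θ → Γ ⊢ apps M Ns ∶ B ∣ Θ
⊢apps ⊢M []         = ⊢M
⊢apps ⊢M (⊢N ∷ ⊢Ns) = ⊢apps (⊢app ⊢M ⊢N) ⊢Ns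

⊢plug : ∀ {Γ Θ k M A} → Γ ⊢K k ∶ A ∣ Θ → Γ ⊢ M ∶ A ∣ Θ → Γ ⊢ plug k M ∶ ⊥' ∣ Θ
⊢plug (erased ⊢Ns)  ⊢M = ⊢apps ⊢M ⊢Ns
⊢plug (throw ⊢Ns i) ⊢M = ⊢name i (⊢apps ⊢M ⊢Ns)

⊢rens : ∀ {Γ Δ Θ Ψ r s Ns A B} → Ren Γ Δ r → Ren Θ Ψ s →
        Γ ⊢ Ns ∶ A ⇛ B ∣ Θ → Δ ⊢ map (ren r s) Ns ∶ A ⇛ B ∣ Ψ
⊢rens h k []         = []
⊢rens h k (⊢N ∷ ⊢Ns) = ⊢ren h k ⊢N ∷ ⊢rens h k ⊢Ns

⊢renK : ∀ {Γ Δ Θ Ψ r s K A} → Ren Γ Δ r → Ren Θ Ψ s →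
        Γ ⊢K K ∶ A ∣ Θ → Δ ⊢K renK r s K ∶ A ∣ Ψ
⊢renK h k (erased ⊢Ns)  = erased (⊢rens h k ⊢Ns)
⊢renK h k (throw ⊢Ns i) = throw (⊢rens h k ⊢Ns) (k i)

record ⊢Env (E : Env) (Γ Θ Δ Ψ : Ctx) : Set where
  constructor _,_
  field
    ⊢onVar  : ∀ {x A} → Γ ∋ x ∶ A → Δ ⊢ onVar E x ∶ A ∣ Ψ
    ⊢onName : ∀ {a A} → Θ ∋ a ∶ A → Δ ⊢K onName E a ∶ A ∣ Ψ
open ⊢Env

⊢underλ : ∀ {E Γ Θ Δ Ψ A} → ⊢Env E Γ Θ Δ Ψ → ⊢Env (underλ E) (A ∷ Γ) Θ (A ∷ Δ) Ψ
⊢underλ ⊢E = (λ { here → ⊢var here ; (there i) → ⊢ren there id (⊢onVar ⊢E i) })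
           , (λ i → ⊢renK there id (⊢onName ⊢E i))

⊢underμ : ∀ {E Γ Θ Δ Ψ A} → ⊢Env E Γ Θ Δ Ψ → ⊢Env (underμ E) Γ (A ∷ Θ) Δ (A ∷ Ψ)
⊢underμ ⊢E = (λ i → ⊢ren id there (⊢onVar ⊢E i))
           , (λ { here → throw [] here ; (there i) → ⊢renK id there (⊢onName ⊢E i) })

⊢act : ∀ {E Γ Θ Δ Ψ M A} → ⊢Env E Γ Θ Δ Ψ → Γ ⊢ M ∶ A ∣ Θ → Δ ⊢ act E M ∶ A ∣ Ψ
⊢act ⊢E (⊢var i)     = ⊢onVar ⊢E i
⊢act ⊢E (⊢lam ⊢M)    = ⊢lam (⊢act (⊢underλ ⊢E) ⊢M)
⊢act ⊢E (⊢app ⊢M ⊢N) = ⊢app (⊢act ⊢E ⊢M) (⊢act ⊢E ⊢N)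
⊢act ⊢E (⊢name i ⊢M) = ⊢plug (⊢onName ⊢E i) (⊢act ⊢E ⊢M)
⊢act ⊢E (⊢mu ⊢M)     = ⊢mu (⊢act (⊢underμ ⊢E) ⊢M)

subject-reduction : ∀ {Γ Θ M N A} → M ⟶ N → Γ ⊢ M ∶ A ∣ Θ → Γ ⊢ N ∶ A ∣ Θ
subject-reduction (β-rule M N) (⊢app (⊢lam ⊢M) ⊢N) rewrite sub≡act (sub0 N) M =
  ⊢act ((λ { here → ⊢N ; (there i) → ⊢var i }) , throw []) ⊢M
subject-reduction (μ-rule M N) (⊢app (⊢mu ⊢M) ⊢N) rewrite srep0≡act (ren id suc N) M =
  ⊢mu (⊢act (⊢var , λ { here → throw (⊢ren id there ⊢N ∷ []) here
                      ; (there i) → throw [] (there i) }) ⊢M)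
subject-reduction (ρ-rule b M) (⊢name i (⊢mu ⊢M)) =
  ⊢ren id (λ { here → i ; (there j) → j }) ⊢M
subject-reduction (θ-rule M) (⊢mu (⊢name here ⊢M)) = ⊢unren M id (λ { (there i) → i }) ⊢M
-- The inner μ is the body of the outer one, so its name has type ⊥, and P can stand in for [β]P.
subject-reduction (ε-rule M) (⊢mu (⊢mu ⊢M)) rewrite erase≡act zero M =
  ⊢mu (⊢act (⊢var , λ { here → erased [] ; (there i) → throw [] i }) ⊢M)
subject-reduction (ξ-lam r)  (⊢lam ⊢M)    = ⊢lam (subject-reduction r ⊢M)
subject-reduction (ξ-appL r) (⊢app ⊢M ⊢N) = ⊢app (subject-reduction r ⊢M) ⊢N
subject-reduction (ξ-appR r) (⊢app ⊢M ⊢N) = ⊢app ⊢M (subject-reduction r ⊢N)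
subject-reduction (ξ-name r) (⊢name i ⊢M) = ⊢name i (subject-reduction r ⊢M)
subject-reduction (ξ-mu r)   (⊢mu ⊢M)     = ⊢mu (subject-reduction r ⊢M)

-- Thin environments only relabel variables and relabel or drop names, hence create
-- no βμ-redex in a typable term: there no [a]P stands in function position.
record Thin (E : Env) : Set where
  constructor _,_
  field
    thin-var  : ∀ x → ∃[ y ] onVar E x ≡ var y
    thin-name : ∀ a → args (onName E a) ≡ []
open Thin

thin-underλ : ∀ {E} → Thin E → Thin (underλ E)
thin-underλ {E} t = onV , (λ a → cong (map (ren suc id)) (thin-name t a))
  where
  onV : ∀ x → ∃[ y ] onVar (underλ E) x ≡ var y
  onV zero    = _ , refl
  onV (suc n) = _ , cong (ren suc id) (proj₂ (thin-var t n))

thin-underμ : ∀ {E} → Thin E → Thin (underμ E)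
thin-underμ t = (λ n → _ , cong (ren id suc) (proj₂ (thin-var t n)))
              , (λ { zero → refl ; (suc n) → cong (map (ren id suc)) (thin-name t n) })

reflect-root : ∀ {E Γ Θ A B y} → Thin E → ∀ P Q → Γ ⊢ P ∶ A ⇒ B ∣ Θ →
               βμ (app (act E P) (act E Q)) y → ∃[ M ] βμ (app P Q) M × y ≡ act E M
reflect-root {E} t (var x) Q ⊢P r with onVar E x | thin-var t x
reflect-root t (var x) Q ⊢P () | .(var y) | y , refl
reflect-root {E} t (lam P) Q ⊢P (β _ _) = _ , β P Q , sym (act-sub0 E P Q)
reflect-root {E} t (mu P)  Q ⊢P (μ _ _) = _ , μ P Q , cong mu (sym (act-srep0 E P Q))
reflect-root t (app _ _) Q ⊢P ()
reflect-root t (name _ _) Q () r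

reflect : ∀ {E Γ Θ M A y} → Thin E → Γ ⊢ M ∶ A ∣ Θ → act E M ⟶βμ y →
          ∃[ M' ] M ⟶βμ M' × y ≡ act E M'
reflect {E} t (⊢var {x = x} i) r with onVar E x | thin-var t x
reflect t (⊢var i) (base ()) | .(var y) | y , refl
reflect t (⊢lam ⊢M) (ξ-lam r) with reflect (thin-underλ t) ⊢M r
... | _ , r' , refl = _ , ξ-lam r' , refl
reflect t (⊢app {M = M} {N = N} ⊢M ⊢N) (base r) with reflect-root t M N ⊢M r
... | _ , r' , eq = _ , base r' , eq
reflect t (⊢app ⊢M ⊢N) (ξ-appL r) with reflect t ⊢M r
... | _ , r' , refl = _ , ξ-appL r' , refl
reflect t (⊢app ⊢M ⊢N) (ξ-appR r) with reflect t ⊢N r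
... | _ , r' , refl = _ , ξ-appR r' , refl
reflect {E} t (⊢name {a = a} i ⊢M) r with onName E a in eq | thin-name t a
reflect {E} t (⊢name {a = a} i ⊢M) r | .[] ⟫ nothing | refl with reflect t ⊢M r
... | M' , r' , refl = _ , ξ-name r' , cong (λ k → plug k (act E M')) (sym eq)
reflect {E} t (⊢name {a = a} i ⊢M) (ξ-name r) | .[] ⟫ just b | refl with reflect t ⊢M r
... | M' , r' , refl = _ , ξ-name r' , cong (λ k → plug k (act E M')) (sym eq)
reflect t (⊢mu ⊢M) (ξ-mu r) with reflect (thin-underμ t) ⊢M r
... | _ , r' , refl = _ , ξ-mu r' , refl

-- Postponement of ρ, θ and ε

srep-shift : ∀ N M → srep zero N (ren id suc M) ≡ ren id suc M
srep-shift N M = trans (srep0≡act N (ren id suc M)) (act-argsEnv-shift (N ∷ []) M)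

sub0-ρθε : ∀ N {M M'} → M ⟶ρθε M' → M [0:= N ] ⟶* M' [0:= N ]
sub0-ρθε N {M} {M'} r rewrite sub≡act (sub0 N) M | sub≡act (sub0 N) M' =
  act-ρθε (λ a → [] , a , refl) r

srep0-ρθε : ∀ N {M M'} → M ⟶ρθε M' → srep zero N M ⟶* srep zero N M'
srep0-ρθε N {M} {M'} r rewrite srep0≡act N M | srep0≡act N M' =
  act-ρθε (λ { zero → _ , _ , refl ; (suc a) → _ , _ , refl }) r

-- If θ fires in function position, the μ-redex it destroys can be contracted first:
-- (μα.[α]M)N → μα.[α](M)N → (M)N.
postpone-θ : ∀ M N → ∃[ W ] app (mu (name zero (ren id suc M))) N ⟶βμ W × W ⟶* app M N
postpone-θ M N = _ , base (μ _ N) ,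
  subst (λ P → mu (name zero (app P (ren id suc N))) ⟶* app M N)
        (sym (srep-shift (ren id suc N) M)) (return (base (inj₂ (θ (app M N)))))

-- The case where the first step produces the function of the redex. ρ is impossible, as [b]P has no
-- arrow type; for ε, replacing at the outer name commutes with erasing the inner one.
postpone-root : ∀ {Γ Θ A B M M' N y} → Γ ⊢ M ∶ A ⇒ B ∣ Θ → M ⟶ρθε M' → βμ (app M' N) y →
                ∃[ W ] app M N ⟶βμ W × W ⟶* y
postpone-root () (base (ρ b M)) s
postpone-root {N = N} ⊢M (base (θ M)) s with postpone-θ M N
-- θ has only exposed M as a function, so `s` remains to be done once (M)N is reached.
... | W , s' , rs = W , s' , rs ◅◅ return (base (inj₁ s))
postpone-root {N = N} ⊢M (base (ε M)) (μ _ _) = _ , base (μ (mu M) N) , collapse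
  where
  collapse : mu (srep zero (ren id suc N) (mu M)) ⟶* mu (srep zero (ren id suc N) (erase zero M))
  collapse rewrite srep0≡act (ren id suc N) (mu M) | srep0≡act (ren id suc N) (erase zero M)
                 | act-erase0 (argsEnv (ren id suc N ∷ [])) M = return (base (inj₂ (ε _)))
postpone-root ⊢M (ξ-lam r) (β _ N) = _ , base (β _ N) , sub0-ρθε N r
postpone-root ⊢M (ξ-mu r)  (μ _ N) = _ , base (μ _ N) , gmap mu ξ-mu (srep0-ρθε (ren id suc N) r)

-- A βμ-step has to come first, because SN will be known for the βμ-reducts of M. The remainder may
-- be empty or long, since contraction drops or copies the part where the other step took place.
postpone : ∀ {Γ Θ A M N y} → Γ ⊢ M ∶ A ∣ Θ → M ⟶ρθε N → N ⟶βμ y →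
           ∃[ W ] M ⟶βμ W × W ⟶* y
-- Renaming is thin, so `s` is the image of a step of M that can be done before ρ. Erasure in the
-- case of ε is treated likewise.
postpone (⊢name i (⊢mu ⊢M)) (base (ρ b M)) s
  with reflect {E = renEnv id (ren0 b)} ((λ x → x , refl) , (λ _ → refl)) ⊢M
         (subst (_⟶βμ _) (ren≡act id (ren0 b) M) s)
... | M' , s' , refl = _ , ξ-name (ξ-mu s') ,
  subst (name b (mu M') ⟶*_) (ren≡act id (ren0 b) M') (return (base (inj₂ (ρ b M'))))
postpone ⊢M (base (θ M)) s = _ , ξ-mu (ξ-name (ren-βμ id suc s)) , return (base (inj₂ (θ _)))
postpone (⊢mu (⊢mu ⊢M)) (base (ε M)) (ξ-mu s)
  with reflect {E = eraseEnv zero} ((λ x → x , refl) , (λ _ → refl)) ⊢M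
         (subst (_⟶βμ _) (erase≡act zero M) s)
... | M' , s' , refl = _ , ξ-mu (ξ-mu s') ,
  subst (λ P → mu (mu M') ⟶* mu P) (erase≡act zero M') (return (base (inj₂ (ε M'))))
postpone (⊢lam ⊢M) (ξ-lam r) (ξ-lam s) with postpone ⊢M r s
... | _ , s' , rs = _ , ξ-lam s' , gmap lam ξ-lam rs
postpone (⊢app ⊢M ⊢N) (ξ-appL r) (base s)   = postpone-root ⊢M r s
postpone (⊢app ⊢M ⊢N) (ξ-appL r) (ξ-appL s) with postpone ⊢M r s
... | _ , s' , rs = _ , ξ-appL s' , gmap _ ξ-appL rs
postpone (⊢app ⊢M ⊢N) (ξ-appL r) (ξ-appR s) =
  _ , ξ-appR s , return (ξ-appL (closure-map inj₂ r))
postpone (⊢app ⊢M ⊢N) (ξ-appR r) (base (β M _)) =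
  _ , base (β M _) , Full.sub0-↠ M (return (closure-map inj₂ r))
postpone (⊢app ⊢M ⊢N) (ξ-appR r) (base (μ M _)) =
  _ , base (μ M _) ,
  gmap mu ξ-mu (Full.srepList-↠ M (return (closure-map inj₂ r) Full.∷ Full.[]))
postpone (⊢app ⊢M ⊢N) (ξ-appR r) (ξ-appL s) =
  _ , ξ-appL s , return (ξ-appR (closure-map inj₂ r))
postpone (⊢app ⊢M ⊢N) (ξ-appR r) (ξ-appR s) with postpone ⊢N r s
... | _ , s' , rs = _ , ξ-appR s' , gmap _ ξ-appR rs
postpone (⊢name i ⊢M) (ξ-name r) (ξ-name s) with postpone ⊢M r s
... | _ , s' , rs = _ , ξ-name s' , gmap _ ξ-name rs
postpone (⊢mu ⊢M) (ξ-mu r) (ξ-mu s) with postpone ⊢M r s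
... | _ , s' , rs = _ , ξ-mu s' , gmap mu ξ-mu rs

-- A measure that ρ, θ and ε decrease

size : Tm → ℕ
size (var x)    = 1
size (lam M)    = suc (size M)
size (app M N)  = size M + size N
size (name a M) = suc (size M)
size (mu M)     = suc (size M)

size-ren : ∀ r s M → size (ren r s M) ≡ size M
size-ren r s (var x)    = refl
size-ren r s (lam M)    = cong suc (size-ren (ext r) s M)
size-ren r s (app M N)  = cong₂ _+_ (size-ren r s M) (size-ren r s N)
size-ren r s (name a M) = cong suc (size-ren r s M)
size-ren r s (mu M)     = cong suc (size-ren r (ext s) M)

size-erase : ∀ a M → size (erase a M) ≤ size M
size-erase a (var x)    = ≤-refl
size-erase a (lam M)    = s≤s (size-erase a M)
size-erase a (app M N)  = +-mono-≤ (size-erase a M) (size-erase a N)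
size-erase a (name b M) with b ≡ᵇ a
... | true  = m≤n⇒m≤1+n (size-erase a M)
... | false = s≤s (size-erase a M)
size-erase a (mu M)     = s≤s (size-erase (suc a) M)

size-ρθε : ∀ {M N} → M ⟶ρθε N → size N < size M
size-ρθε (base (ρ b M)) = s≤s (m≤n⇒m≤1+n (≤-reflexive (size-ren id (ren0 b) M)))
size-ρθε (base (θ M))   = s≤s (m≤n⇒m≤1+n (≤-reflexive (sym (size-ren id suc M))))
size-ρθε (base (ε M))   = s≤s (s≤s (size-erase zero M))
size-ρθε (ξ-lam r)              = s≤s (size-ρθε r)
size-ρθε (ξ-appL {N = N} r)     = +-monoˡ-< (size N) (size-ρθε r)
size-ρθε (ξ-appR {M = M} r)     = +-monoʳ-< (size M) (size-ρθε r)
size-ρθε (ξ-name r)             = s≤s (size-ρθε r)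
size-ρθε (ξ-mu r)               = s≤s (size-ρθε r)

-- Strong normalization

SNβμ : Tm → Set
SNβμ = Acc (flip _⟶βμ_)

SN⇒SNβμ : ∀ {M} → SN M → SNβμ M
SN⇒SNβμ (sn h) = acc (λ r → SN⇒SNβμ (h _ (βμ⇒⟶ r)))

SN-* : ∀ {M N} → M ⟶* N → SN M → SN N
SN-* ε        p      = p
SN-* (r ◅ rs) (sn h) = SN-* rs (h _ (closure⇒⟶ r))

SNβμ-* : ∀ {M N} → Star _⟶βμ_ M N → SNβμ M → SNβμ N
SNβμ-* ε        p       = p
SNβμ-* (r ◅ rs) (acc h) = SNβμ-* rs (h r)

-- The outer induction, on SN for βμ, makes all βμ-reducts SN for R; the inner one, on size, then
-- deals with ρ, θ and ε. Subject reduction keeps `postpone` applicable in both.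
SNβμ⇒SN : ∀ {Γ Θ M A} → Γ ⊢ M ∶ A ∣ Θ → SNβμ M → SN M
SNβμ⇒SN {Γ} {Θ} {M} {A} ⊢M (acc h) =
  by-size (<-wellFounded (size M)) ⊢M
    (λ s → SNβμ⇒SN (subject-reduction (βμ⇒⟶ s) ⊢M) (h s))
  where
  by-size : ∀ {M} → Acc _<_ (size M) → Γ ⊢ M ∶ A ∣ Θ → (∀ {N} → M ⟶βμ N → SN N) → SN M
  by-size {M} (acc smaller) ⊢M reducts = sn (λ N r → step (closure-split (⟶⇒closure r)))
    where
    step : ∀ {N} → M ⟶βμ N ⊎ M ⟶ρθε N → SN N
    step (inj₁ s) = reducts s
    step (inj₂ r) = by-size (smaller (size-ρθε r)) (subject-reduction (ρθε⇒⟶ r) ⊢M)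
      -- The reduct inherits the hypothesis: each of its βμ-reducts is reached by R-steps from a
      -- βμ-reduct of M.
      (λ s → let W , s' , rs = postpone ⊢M r s in SN-* rs (reducts s'))

-- Closure conditions for SN of βμ

SNβμ-lam : ∀ {M} → SNβμ M → SNβμ (lam M)
SNβμ-lam (acc h) = acc (λ { (ξ-lam r) → SNβμ-lam (h r) })

SNβμ-mu : ∀ {M} → SNβμ M → SNβμ (mu M)
SNβμ-mu (acc h) = acc (λ { (ξ-mu r) → SNβμ-mu (h r) })

SNβμ-name : ∀ {a M} → SNβμ M → SNβμ (name a M)
SNβμ-name (acc h) = acc (λ { (ξ-name r) → SNβμ-name (h r) })

infix 4 _⟶s_
data _⟶s_ : List Tm → List Tm → Set where
  here  : ∀ {N N' Ns} → N ⟶βμ N' → N ∷ Ns ⟶s N' ∷ Ns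
  there : ∀ {N Ns Ns'} → Ns ⟶s Ns' → N ∷ Ns ⟶s N ∷ Ns'

apps-steps : ∀ M {Ns Ns'} → Ns ⟶s Ns' → apps M Ns ⟶βμ apps M Ns'
apps-steps M (here {Ns = Ns} r) = apps-step Ns (ξ-appR r)
apps-steps M (there {N} rs)     = apps-steps (app M N) rs

⟶s⇒↠s : ∀ {Ns Ns'} → Ns ⟶s Ns' → Ns Mono.↠s Ns'
⟶s⇒↠s (here r)   = return r Mono.∷ Mono.↠s-refl _
⟶s⇒↠s (there rs) = ε Mono.∷ ⟶s⇒↠s rs

data Inert : Tm → Set where
  var : ∀ {x} → Inert (var x)
  app : ∀ {M N} → Inert (app M N)

data AppsStep (H : Tm) (Ns : List Tm) : Tm → Set where
  in-head : ∀ {H'} → H ⟶βμ H' → AppsStep H Ns (apps H' Ns)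
  in-args : ∀ {Ns'} → Ns ⟶s Ns' → AppsStep H Ns (apps H Ns')

-- The only redex that could join H to an argument is `app H N`, excluded by the shape of H; every
-- longer application has an application as its function.
apps-inv : ∀ {H y} → Inert H → ∀ Ns → apps H Ns ⟶βμ y → AppsStep H Ns y
apps-inv i []       r = in-head r
apps-inv i (N ∷ Ns) r with apps-inv app Ns r
apps-inv () (N ∷ Ns) r | in-head (base (β _ _))
apps-inv () (N ∷ Ns) r | in-head (base (μ _ _))
apps-inv i (N ∷ Ns) r  | in-head (ξ-appL s) = in-head s
apps-inv i (N ∷ Ns) r  | in-head (ξ-appR s) = in-args (here s)
apps-inv i (N ∷ Ns) r  | in-args rs         = in-args (there rs)

-- The order for C6: contracting (μα.M)N P̄ hands N over to M, shortening the arguments.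
infix 4 _≻_
data _≻_ : List Tm → List Tm → Set where
  step : ∀ {Ns Ns'} → Ns ⟶s Ns' → Ns ≻ Ns'
  drop : ∀ {N Ns} → N ∷ Ns ≻ Ns

≻-acc : ∀ {Ns} → All SNβμ Ns → Acc (flip _≻_) Ns
≻-acc []       = acc λ { (step ()) }
≻-acc (p ∷ ps) = cons p (≻-acc ps)
  where
  cons : ∀ {N Ns} → SNβμ N → Acc (flip _≻_) Ns → Acc (flip _≻_) (N ∷ Ns)
  cons (acc h) (acc k) = acc λ
    { (step (here r))   → cons (h r) (acc k)
    ; (step (there rs)) → cons (acc h) (k (step rs))
    ; drop              → acc k }

SNβμ-var : ∀ {x Ns} → Acc (flip _≻_) Ns → SNβμ (apps (var x) Ns)
SNβμ-var {x} {Ns} (acc k) = acc (λ r → reduct (apps-inv var Ns r))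
  where
  reduct : ∀ {y} → AppsStep (var x) Ns y → SNβμ y
  reduct (in-head (base ()))
  reduct (in-args rs) = SNβμ-var (k (step rs))

sub0-βμ : ∀ N {M M'} → M ⟶βμ M' → M [0:= N ] ⟶βμ M' [0:= N ]
sub0-βμ N {M} {M'} r rewrite sub≡act (sub0 N) M | sub≡act (sub0 N) M' = act-βμ _ r

srepList-βμ : ∀ Ns {M M'} → M ⟶βμ M' → srepList Ns M ⟶βμ srepList Ns M'
srepList-βμ Ns {M} {M'} r rewrite srepList≡act Ns M | srepList≡act Ns M' = act-βμ _ r

-- A step in M or in the Ps is one step of the contractum. A step in N may leave no trace there, if
-- x does not occur in M, so SN of N is the leading component of the induction.
SNβμ-β : ∀ {M N} Ps → SNβμ N → SNβμ (apps (M [0:= N ]) Ps) → SNβμ (apps (app (lam M) N) Ps)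
SNβμ-β {M} {N} Ps p q = acc (λ r → reduct p q (apps-inv app Ps r))
  where
  reduct : ∀ {y} → SNβμ N → SNβμ (apps (M [0:= N ]) Ps) → AppsStep (app (lam M) N) Ps y → SNβμ y
  reduct p       q       (in-head (base (β _ _)))     = q
  reduct p       (acc k) (in-head (ξ-appL (ξ-lam r))) = SNβμ-β Ps p (k (apps-step Ps (sub0-βμ N r)))
  reduct (acc h) q       (in-head (ξ-appR r))         =
    SNβμ-β Ps (h r) (SNβμ-* (gmap _ (apps-step Ps) (Mono.sub0-↠ M (return r))) q)
  reduct p       (acc k) (in-args {Ns'} rs)           = SNβμ-β Ns' p (k (apps-steps _ rs))

-- As for β, a step in an argument can vanish from the contractum when α does not occur in M, so the
-- argument list leads the induction.
SNβμ-μ : ∀ {M} Ns → Acc (flip _≻_) Ns → SNβμ (mu (srepList Ns M)) → SNβμ (apps (mu M) Ns)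
SNβμ-μ     []       _ q = q
SNβμ-μ {M} (N ∷ Ns) p q = acc (λ r → reduct p q (apps-inv app Ns r))
  where
  reduct-args : ∀ {Ns'} → Acc (flip _≻_) (N ∷ Ns) → SNβμ (mu (srepList (N ∷ Ns) M)) →
                N ∷ Ns ⟶s Ns' → SNβμ (apps (mu M) Ns')
  reduct-args (acc h) q rs =
    SNβμ-μ _ (h (step rs)) (SNβμ-* (gmap mu ξ-mu (Mono.srepList-↠ M (⟶s⇒↠s rs))) q)
  reduct : ∀ {y} → Acc (flip _≻_) (N ∷ Ns) → SNβμ (mu (srepList (N ∷ Ns) M)) →
           AppsStep (app (mu M) N) Ns y → SNβμ y
  -- `srepList (N ∷ Ns) M` unfolds to `srepList Ns` of the new body, so `q` serves unchanged and
  -- only the list descends.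
  reduct (acc h) q       (in-head (base (μ _ _)))    = SNβμ-μ Ns (h drop) q
  reduct p       (acc k) (in-head (ξ-appL (ξ-mu r))) =
    SNβμ-μ (N ∷ Ns) p (k (ξ-mu (srepList-βμ (N ∷ Ns) r)))
  reduct p       q       (in-head (ξ-appR r))        = reduct-args p q (here r)
  reduct p       q       (in-args rs)                = reduct-args p q (there rs)

-- Unlike the other conditions, (C1) does not assume the compound term to be typable.
typable-lam : ∀ {M} → Typable M → Typable (lam M)
-- An empty context offers no variable to abstract, so one of the arbitrary type ⊥ is added; M has
-- no free λ-variable, and its indices stay as they are.
typable-lam {M} ([] , A , Θ , ⊢M) =
  [] , _ , Θ , ⊢lam {A = ⊥'} (subst (λ P → _ ⊢ P ∶ A ∣ Θ) (ren-id M) (⊢ren (λ ()) id ⊢M))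
typable-lam (B ∷ Γ , A , Θ , ⊢M) = Γ , _ , Θ , ⊢lam ⊢M

SNβμ⇒SN∩Tt : ∀ {M} → SNβμ M → Typable M → SN∩Tt M
SNβμ⇒SN∩Tt p t@(_ , _ , _ , ⊢M) = SNβμ⇒SN ⊢M p , t

SN∩Tt⇒SNβμ : ∀ {M} → SN∩Tt M → SNβμ M
SN∩Tt⇒SNβμ = SN⇒SNβμ ∘ proj₁

theorem4p15 : Saturated SN∩Tt
theorem4p15 = record
  { sub-Tt = λ _ → proj₂
  ; C1     = λ _ b → SNβμ⇒SN∩Tt (SNβμ-lam (SN∩Tt⇒SNβμ b)) (typable-lam (proj₂ b))
  ; C2     = λ _ b → SNβμ⇒SN∩Tt (SNβμ-mu (SN∩Tt⇒SNβμ b))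
  ; C3     = λ _ _ b → SNβμ⇒SN∩Tt (SNβμ-name (SN∩Tt⇒SNβμ b))
  ; C4     = λ _ _ bs → SNβμ⇒SN∩Tt (SNβμ-var (≻-acc (All-map SN∩Tt⇒SNβμ bs)))
  ; C5     = λ _ _ Ps _ _ _ bN t b →
      SNβμ⇒SN∩Tt (SNβμ-β Ps (SN∩Tt⇒SNβμ bN) (SN∩Tt⇒SNβμ b)) t
  ; C6     = λ _ Ns _ bs t b →
      SNβμ⇒SN∩Tt (SNβμ-μ Ns (≻-acc (All-map SN∩Tt⇒SNβμ bs)) (SN∩Tt⇒SNβμ b)) t
  }
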